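{- Disjunction $\vee$ is not strongly definable in $\mathtt{NI}^2_{at}$; that is, it is not the case that for all $A,B\in\mathcal L^\vee$ there is a formula $C\in\mathcal L^2$ such that $C\dashv\vdash_{\mathtt{NI}^{2\vee}_{at}}A\vee B$.
   Context: Formulas, with $X$ ranging over propositional variables: $\mathcal L^2$: $A::=X\mid A\supset B\mid\forall X.A$; $\mathcal L^\vee$: $A::=X\mid A\supset B\mid A\vee B$; $\mathcal L^{2\vee}$: $A::=X\mid A\supset B\mid A\vee B\mid\forall X.A$. $\mathtt{NI}^{2\vee}_{at}$ is the natural deduction system over $\mathcal L^{2\vee}$ with the standard intuitionistic introduction and elimination rules for $\supset$ and $\vee$, the rule $\forall$I (from $A$ infer $\forall X.A$, provided $X$ is not free in the undischarged assumptions), and the atomic elimination rule $\forall$E$_{at}$: from $\forall X.A$ infer $A\llbracket Y/X\rrbracket$, where $Y$ must be a propositional variable. $\mathtt{NI}^2_{at}$ is its restriction to $\mathcal L^2$ (atomic System F). $A\dashv\vdash_{\mathtt{NI}^{2\vee}_{at}}B$ means that each of $A,B$ is derivable from the other in $\mathtt{NI}^{2\vee}_{at}$. Disjunction is called strongly definable in $\mathtt{NI}^2_{at}$ iff for all $A,B\in\mathcal L^\vee$ there is an $\mathcal L^2$-formula $C$ such that $C\dashv\vdash_{\mathtt{NI}^{2\vee}_{at}}A\vee B$. -}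

module Defs where

open import Data.List.Base using (List; []; _∷_; map)
open import Data.List.Membership.Propositional using (_∈_)
open import Data.Nat.Base using (ℕ; zero; suc)
open import Data.Product.Base using (_×_; ∃-syntax)

infixr 6 _⊃_
infixr 7 _∨_
infix  8 _[_]
infix  4 _⊢_ _⊣⊢_

-- Formulas of 𝓛²ᵛ up to α-equivalence.  Propositional variables are de Bruijn
-- indices: under k quantifiers, the index k + i denotes the i-th of the
-- countably many free variables.

data Formula : Set where
  var : ℕ → Formula
  _⊃_ : Formula → Formula → Formula
  _∨_ : Formula → Formula → Formula
  ∀∙_ : Formula → Formula

-- The sublanguages 𝓛² (no ∨) and 𝓛ᵛ (no ∀).

data 𝓛² : Formula → Set where
  var : ∀ x → 𝓛² (var x)
  _⊃_ : ∀ {A B} → 𝓛² A → 𝓛² B → 𝓛² (A ⊃ B)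
  ∀∙_ : ∀ {A} → 𝓛² A → 𝓛² (∀∙ A)

data 𝓛ᵛ : Formula → Set where
  var : ∀ x → 𝓛ᵛ (var x)
  _⊃_ : ∀ {A B} → 𝓛ᵛ A → 𝓛ᵛ B → 𝓛ᵛ (A ⊃ B)
  _∨_ : ∀ {A B} → 𝓛ᵛ A → 𝓛ᵛ B → 𝓛ᵛ (A ∨ B)

lift : (ℕ → ℕ) → ℕ → ℕ
lift ρ zero    = zero
lift ρ (suc x) = suc (ρ x)

rename : (ℕ → ℕ) → Formula → Formula
rename ρ (var x) = var (ρ x)
rename ρ (A ⊃ B) = rename ρ A ⊃ rename ρ B
rename ρ (A ∨ B) = rename ρ A ∨ rename ρ B
rename ρ (∀∙ A)  = ∀∙ rename (lift ρ) A

weaken : Formula → Formula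
weaken = rename suc

inst : ℕ → ℕ → ℕ
inst y zero    = y
inst y (suc x) = x

-- A [ y ] is A⟦Y/X⟧, for A the body of ∀X.A.

_[_] : Formula → ℕ → Formula
A [ y ] = rename (inst y) A

-- Derivability in NI²ᵛ_at: Γ ⊢ A says that A has a derivation whose
-- undischarged assumptions are all among Γ.  In ∀I the bound variable has
-- index 0, and weakening Γ ensures that it is not free in the assumptions.

data _⊢_ (Γ : List Formula) : Formula → Set where
  ax   : ∀ {A} → A ∈ Γ → Γ ⊢ A
  ⊃I   : ∀ {A B} → A ∷ Γ ⊢ B → Γ ⊢ A ⊃ B
  ⊃E   : ∀ {A B} → Γ ⊢ A ⊃ B → Γ ⊢ A → Γ ⊢ B
  ∨I₁  : ∀ {A B} → Γ ⊢ A → Γ ⊢ A ∨ B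
  ∨I₂  : ∀ {A B} → Γ ⊢ B → Γ ⊢ A ∨ B
  ∨E   : ∀ {A B C} → Γ ⊢ A ∨ B → A ∷ Γ ⊢ C → B ∷ Γ ⊢ C → Γ ⊢ C
  ∀I   : ∀ {A} → map weaken Γ ⊢ A → Γ ⊢ ∀∙ A
  ∀Eat : ∀ {A} → Γ ⊢ ∀∙ A → (y : ℕ) → Γ ⊢ A [ y ]

_⊣⊢_ : Formula → Formula → Set
A ⊣⊢ B = (A ∷ [] ⊢ B) × (B ∷ [] ⊢ A)

∨-StronglyDefinable : Set
∨-StronglyDefinable =
  ∀ A B → 𝓛ᵛ A → 𝓛ᵛ B → ∃[ C ] (𝓛² C × C ⊣⊢ A ∨ B)

{-# OPTIONS --safe #-}
module Submission where

-- The formula X ∨ Y, for distinct variables X and Y, has no equivalent in 𝓛².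
--
-- Since ∀E instantiates with variables only, NI²ᵛ_at is sound for Kripke
-- models in which the quantified variables range over an arbitrary set of
-- propositions containing the values of the free variables.  Take the frame with
-- a root below two incomparable leaves, and let variables range over just two
-- propositions, "being the first leaf" and "being the second leaf" (`sound`).
-- In this model every 𝓛²-formula forced at both leaves is forced at the root
-- (`leaves⇒root`): no variable is forced at both leaves, and the property is
-- preserved by implication and by intersection.  If X and Y denote the two
-- different propositions, then X ∨ Y is forced at both leaves but not at the
-- root, so it is not equivalent to any 𝓛²-formula.

open import Data.Bool.Base using (Bool; true; false)
open import Data.List.Base using ([]; _∷_)
open import Data.List.Relation.Unary.All as All using (All; []; _∷_)
open import Data.List.Relation.Unary.All.Properties using (map⁺)
open import Data.Nat.Base using (ℕ; zero; suc)
open import Data.Product.Base using (_,_)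
open import Data.Sum.Base as Sum using (_⊎_; inj₁; inj₂)
open import Function.Bundles using (_⇔_; mk⇔; Equivalence)
open import Relation.Binary.PropositionalEquality using (_≡_; refl; sym; trans; cong)
open import Relation.Nullary using (¬_)
open import Defs

open Equivalence using (to; from)

infixr 5 _◂_
infix  4 _≼_ _,_⊩_

-- The frame: a root with two leaves above it.

data World : Set where
  root : World
  leaf : Bool → World

data _≼_ : World → World → Set where
  ≼-refl    : ∀ {w} → w ≼ w
  root≼leaf : ∀ {b} → root ≼ leaf b

≼-trans : ∀ {u v w} → u ≼ v → v ≼ w → u ≼ w
≼-trans ≼-refl    q      = q
≼-trans root≼leaf ≼-refl = root≼leaf

-- A valuation sends each free variable to a Boolean b, which stands for the
-- proposition {leaf b}.

Valuation : Set
Valuation = ℕ → Bool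

-- The valuation of the free variables of a quantified body, whose bound
-- variable denotes {leaf b}.

_◂_ : Bool → Valuation → Valuation
(b ◂ ρ) zero    = b
(b ◂ ρ) (suc x) = ρ x

-- Forcing, with quantifiers ranging over the two propositions {leaf b} only.

_,_⊩_ : World → Valuation → Formula → Set
w , ρ ⊩ var x   = w ≡ leaf (ρ x)
w , ρ ⊩ (A ⊃ B) = ∀ v → w ≼ v → v , ρ ⊩ A → v , ρ ⊩ B
w , ρ ⊩ (A ∨ B) = w , ρ ⊩ A ⊎ w , ρ ⊩ B
w , ρ ⊩ (∀∙ A)  = ∀ b → w , b ◂ ρ ⊩ A

⊩-mono : ∀ A {ρ w v} → w ≼ v → w , ρ ⊩ A → v , ρ ⊩ A
⊩-mono (var x) ≼-refl f        = f
⊩-mono (A ⊃ B) p      f        = λ u q → f u (≼-trans p q)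
⊩-mono (A ∨ B) p      (inj₁ f) = inj₁ (⊩-mono A p f)
⊩-mono (A ∨ B) p      (inj₂ f) = inj₂ (⊩-mono B p f)
⊩-mono (∀∙ A)  p      f        = λ b → ⊩-mono A p (f b)

-- Renaming a formula amounts to reindexing the valuation.  The valuations are
-- related pointwise because functions are not compared extensionally by _≡_.

⊩-rename : ∀ A {σ ρ ρ′ w} → (∀ x → ρ (σ x) ≡ ρ′ x) →
           w , ρ ⊩ rename σ A ⇔ w , ρ′ ⊩ A
⊩-rename (var x) e =
  mk⇔ (λ p → trans p (cong leaf (e x))) (λ p → trans p (cong leaf (sym (e x))))
⊩-rename (A ⊃ B) e =
  mk⇔ (λ f v p a → to   (⊩-rename B e) (f v p (from (⊩-rename A e) a)))
      (λ f v p a → from (⊩-rename B e) (f v p (to   (⊩-rename A e) a)))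
⊩-rename (A ∨ B) e =
  mk⇔ (Sum.map (to   (⊩-rename A e)) (to   (⊩-rename B e)))
      (Sum.map (from (⊩-rename A e)) (from (⊩-rename B e)))
⊩-rename (∀∙ A) {σ} {ρ} {ρ′} e =
  mk⇔ (λ f b → to   (⊩-rename A (e↑ b)) (f b))
      (λ f b → from (⊩-rename A (e↑ b)) (f b))
  where
  e↑ : ∀ b x → (b ◂ ρ) (lift σ x) ≡ (b ◂ ρ′) x
  e↑ b zero    = refl
  e↑ b (suc x) = e x

⊩-weaken : ∀ A {b ρ w} → w , ρ ⊩ A → w , b ◂ ρ ⊩ weaken A
⊩-weaken A = from (⊩-rename A (λ _ → refl))

-- The instance of a body at y is the body with its bound variable denoting the
-- value of y; this is the step that needs instances to be variables.

⊩-inst : ∀ A y {ρ w} → w , ρ y ◂ ρ ⊩ A → w , ρ ⊩ A [ y ]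
⊩-inst A y {ρ} = from (⊩-rename A agree)
  where
  agree : ∀ x → ρ (inst y x) ≡ (ρ y ◂ ρ) x
  agree zero    = refl
  agree (suc x) = refl

sound : ∀ {Γ A} → Γ ⊢ A → ∀ {ρ w} → All (w , ρ ⊩_) Γ → w , ρ ⊩ A
sound (ax i)           γ = All.lookup γ i
sound (⊃I d)           γ = λ _ p a → sound d (a ∷ All.map (λ {B} → ⊩-mono B p) γ)
sound (⊃E d e)         γ = sound d γ _ ≼-refl (sound e γ)
sound (∨I₁ d)          γ = inj₁ (sound d γ)
sound (∨I₂ d)          γ = inj₂ (sound d γ)
sound (∨E d e₁ e₂)     γ with sound d γ
... | inj₁ a             = sound e₁ (a ∷ γ)
... | inj₂ b             = sound e₂ (b ∷ γ)
sound (∀I d)           γ = λ b → sound d (map⁺ (All.map (λ {B} → ⊩-weaken B) γ))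
sound (∀Eat {A} d y) {ρ} γ = ⊩-inst A y (sound d γ (ρ y))

-- In the case of A ⊃ B, only the root itself is in question: if it forces A,
-- so do both leaves, which therefore force B.

leaves⇒root : ∀ {C} → 𝓛² C → ∀ {ρ} → (∀ b → leaf b , ρ ⊩ C) → root , ρ ⊩ C
leaves⇒root (var x) f with trans (f true) (sym (f false))
... | ()
leaves⇒root (_⊃_ {A} {B} a b) f _ ≼-refl    r =
  leaves⇒root b (λ c → f c _ ≼-refl (⊩-mono A root≼leaf r))
leaves⇒root (_⊃_ {A} {B} a b) f _ root≼leaf r = f _ _ ≼-refl r
leaves⇒root (∀∙ a) f = λ c → leaves⇒root a (λ b → f b c)

-- The first two variables denote different propositions; the values of the
-- others do not matter.

separating : Valuation
separating zero    = false
separating (suc _) = true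

leaf⊩∨ : ∀ b → leaf b , separating ⊩ (var 0 ∨ var 1)
leaf⊩∨ false = inj₁ refl
leaf⊩∨ true  = inj₂ refl

root⊮∨ : ¬ (root , separating ⊩ (var 0 ∨ var 1))
root⊮∨ (inj₁ ())
root⊮∨ (inj₂ ())

proposition8 : ¬ ∨-StronglyDefinable
proposition8 definable with definable (var 0) (var 1) (var 0) (var 1)
... | C , C∈𝓛² , C⊢∨ , ∨⊢C =
  root⊮∨ (sound C⊢∨ (leaves⇒root C∈𝓛² {separating} (λ b → sound ∨⊢C (leaf⊩∨ b ∷ [])) ∷ []))
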